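{- Let $G$ be an ST graph with no twins. Then $G$ is DI if and only if $\mathrm{Join}(G)$ is dedekind.
   Context: A digraph is a finite vertex set $V$ with arc set $E\subseteq V\times V$ (loops allowed). $N^+(v),N^-(v)$ are out-/in-neighborhoods, $N(v)=N^+(v)\cup N^-(v)$, $d(v)=|N(v)|$. Source: $N^-(v)=\emptyset$; sink: $N^+(v)=\emptyset$; ST graph: every vertex is a source or a sink. Two distinct vertices are twins if $N(v)=N(w)$. An arc $v\to w$ is disimplicial if $x\to y$ is an arc for all $x\in N^-(w)$, $y\in N^+(v)$. A diclique is a pair $(V,W)$ of nonempty vertex sets with $v\to w$ an arc for all $v\in V,w\in W$; it contains the arc $v\to w$ if $v\in V,w\in W$; maximal if not properly contained componentwise in another diclique; reduced if maximal and containing a disimplicial arc. A digraph is DI if every maximal diclique is reduced. The thin neighbor $\theta(v)$ is the unique $x\in N(v)$ with $d(x)<d(z)$ for all $z\in N(v)\setminus\{x\}$ (undefined if none); $v\to w$ is thin if $\theta(v)=w$, $\theta(w)=v$; thin arcs form a matching $M$ with endpoint set $V(M)$. $\mathrm{Join}(G)$ has a vertex $(v,v)$ for each $v\notin V(M)$ and a vertex $(v,w)$ for each $v\to w\in M$, with $(v,w)\to(x,y)$ an arc iff $v\to y\in E(G)$. An order graph is a reflexive, transitive, oriented digraph. In a digraph $D$, for $X\subseteq V(D)$, $\mu(X)=\{u: x\to u \text{ for all } x\in X\}$ (upper bounds) and $\lambda(X)=\{\ell:\ell\to x\text{ for all }x\in X\}$ (lower bounds); $X$ is bounded from above if $\mu(X)\neq\emptyset$;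 a supremum of $X$ is an element of $\mu(X)\cap\lambda(\mu(X))$. A dedekind graph is an order graph in which every nonempty vertex set bounded from above has a supremum.
   Formalization: The theorem additionally assumes that G has no isolated vertices; without this it fails, e.g. a single vertex with no arcs is an ST graph without twins and vacuously DI, but its Join is one loopless vertex, hence not reflexive and not dedekind. -}

module Defs where

open import Data.Fin using (Fin)
open import Data.Fin.Properties using (_≟_; all?; any?)
open import Data.Fin.Subset using (Subset; _∈_; _⊆_; _∪_; ∣_∣; Nonempty; Empty)
open import Data.Fin.Subset.Properties using (_∈?_)
open import Data.List using (List; length; lookup; filter; cartesianProduct; allFin)
open import Data.Nat using (ℕ; _<_; _<?_)
open import Data.Product using (_×_; _,_; ∃; ∃₂; proj₁; proj₂)
open import Data.Sum using (_⊎_)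
open import Data.Vec using (tabulate)
open import Level using (0ℓ)
open import Relation.Binary using (Rel; Reflexive; Transitive; Antisymmetric)
import Relation.Binary as B
open import Relation.Binary.PropositionalEquality using (_≡_; _≢_)
open import Relation.Nullary using (¬_; does)
open import Relation.Nullary.Decidable using (¬?; _×-dec_; _⊎-dec_; _→-dec_)
open import Relation.Unary using (Pred; Decidable)

-- Vertex set {0, …, n-1}.  Arcs are decidable, as they are for any finite
-- digraph given by its arc set; loops are allowed.
record Digraph (n : ℕ) : Set₁ where
  field
    _⟶_  : Rel (Fin n) 0ℓ
    _⟶?_ : B.Decidable _⟶_

⟦_⟧ : ∀ {n} {P : Pred (Fin n) 0ℓ} → Decidable P → Subset n
⟦ P? ⟧ = tabulate (λ x → does (P? x))

module _ {n : ℕ} (G : Digraph n) where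
  open Digraph G

  N⁺ N⁻ N : Fin n → Subset n
  N⁺ v = ⟦ (λ w → v ⟶? w) ⟧
  N⁻ v = ⟦ (λ w → w ⟶? v) ⟧
  N v  = N⁺ v ∪ N⁻ v

  deg : Fin n → ℕ
  deg v = ∣ N v ∣

  Source Sink : Fin n → Set
  Source v = Empty (N⁻ v)
  Sink v   = Empty (N⁺ v)

  -- An isolated vertex is both a source and a sink and lies in no diclique,
  -- but it survives in Join as a vertex without a loop, so Join is then not
  -- reflexive.
  Isolated : Fin n → Set
  Isolated v = Empty (N v)

  IsST : Set
  IsST = ∀ v → Source v ⊎ Sink v

  Twins : Fin n → Fin n → Set
  Twins v w = v ≢ w × N v ≡ N w

  Disimplicial : Fin n → Fin n → Set
  Disimplicial v w =
    v ⟶ w × (∀ x y → x ∈ N⁻ w → y ∈ N⁺ v → x ⟶ y)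

  IsDiclique : Subset n × Subset n → Set
  IsDiclique (V , W) =
    Nonempty V × Nonempty W × (∀ v w → v ∈ V → w ∈ W → v ⟶ w)

  ProperlyContained : (C D : Subset n × Subset n) → Set
  ProperlyContained (V , W) (V′ , W′) =
    V ⊆ V′ × W ⊆ W′ × (V , W) ≢ (V′ , W′)

  IsMaximalDiclique : Subset n × Subset n → Set
  IsMaximalDiclique C =
    IsDiclique C × (∀ D → IsDiclique D → ¬ ProperlyContained C D)

  IsReducedDiclique : Subset n × Subset n → Set
  IsReducedDiclique (V , W) =
    IsMaximalDiclique (V , W) ×
    (∃₂ λ v w → v ∈ V × w ∈ W × Disimplicial v w)

  IsDI : Set
  IsDI = ∀ C → IsMaximalDiclique C → IsReducedDiclique C

  -- θ(v) is partial, so it is given by its graph.  The strict inequality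
  -- leaves at most one such x, so uniqueness is not a separate clause.
  _IsThinNeighborOf_ : Fin n → Fin n → Set
  x IsThinNeighborOf v =
    x ∈ N v × (∀ z → z ∈ N v → z ≢ x → deg x < deg z)

  Thin : Fin n → Fin n → Set
  Thin v w = v ⟶ w × w IsThinNeighborOf v × v IsThinNeighborOf w

  -- Membership in V(M), where M is the matching of thin arcs.
  Matched : Fin n → Set
  Matched v = ∃ λ w → Thin v w ⊎ Thin w v

  JoinVertex : Pred (Fin n × Fin n) 0ℓ
  JoinVertex (v , w) = (v ≡ w × ¬ Matched v) ⊎ Thin v w

  thinNeighbor? : B.Decidable _IsThinNeighborOf_
  thinNeighbor? x v =
    (x ∈? N v) ×-dec
    all? (λ z → (z ∈? N v) →-dec (¬? (z ≟ x) →-dec (deg x <? deg z)))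

  thin? : B.Decidable Thin
  thin? v w = (v ⟶? w) ×-dec (thinNeighbor? w v ×-dec thinNeighbor? v w)

  matched? : Decidable Matched
  matched? v = any? (λ w → thin? v w ⊎-dec thin? w v)

  joinVertex? : Decidable JoinVertex
  joinVertex? (v , w) = ((v ≟ w) ×-dec ¬? (matched? v)) ⊎-dec thin? v w

  -- The vertices of Join, each listed exactly once.
  joinVertices : List (Fin n × Fin n)
  joinVertices = filter joinVertex? (cartesianProduct (allFin n) (allFin n))

  -- Vertex i of Join stands for the pair at position i of joinVertices.
  Join : Digraph (length joinVertices)
  Join = record
    { _⟶_  = λ i j → proj₁ (pair i) ⟶ proj₂ (pair j)
    ; _⟶?_ = λ i j → proj₁ (pair i) ⟶? proj₂ (pair j)
    }
    where
    pair : Fin (length joinVertices) → Fin n × Fin n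
    pair = lookup joinVertices

  -- Antisymmetry is orientedness: no two distinct vertices are joined by
  -- arcs in both directions.
  IsOrderGraph : Set
  IsOrderGraph = Reflexive _⟶_ × Transitive _⟶_ × Antisymmetric _≡_ _⟶_

  upperBounds lowerBounds : Subset n → Subset n
  upperBounds X = ⟦ (λ u → all? (λ x → (x ∈? X) →-dec (x ⟶? u))) ⟧
  lowerBounds X = ⟦ (λ l → all? (λ x → (x ∈? X) →-dec (l ⟶? x))) ⟧

  IsSupremum : Fin n → Subset n → Set
  IsSupremum s X = s ∈ upperBounds X × s ∈ lowerBounds (upperBounds X)

  IsDedekind : Set
  IsDedekind = IsOrderGraph ×
    (∀ X → Nonempty X → Nonempty (upperBounds X) → ∃ λ s → IsSupremum s X)

{-# OPTIONS --safe #-}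
-- For an arc v → w of an ST graph, disimpliciality says N(v) ⊆ N(x) for all
-- x ∈ N(w) and N(w) ⊆ N(y) for all y ∈ N(v); without twins these inclusions
-- are strict for x ≠ v and y ≠ w, so disimplicial arcs are thin.
-- If G is DI, applying this to the dicliques (λ(μ(X)), μ(X)) with X = {v} and
-- with X = λ({w}) puts every vertex on a disimplicial arc; hence the thin arcs
-- are exactly the disimplicial ones and match all vertices, and a disimplicial
-- arc inside (λ(μ(X)), μ(X)) is a supremum in Join(G).
-- Conversely, reflexivity of Join(G) says that all vertices are matched,
-- transitivity that thin arcs are disimplicial, and the supremum of the sources
-- of a maximal diclique is a thin arc inside it.
module Submission where

open import Defs
open import Data.Fin using (Fin; zero; suc)
open import Data.Fin.Properties using (_≟_; all?; any?)
open import Data.Fin.Subset using (Subset; _∈_; _⊆_; _⊂_; Nonempty; ⁅_⁆)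
open import Data.Fin.Subset.Properties
  using (_∈?_; _⊂?_; ⊆-antisym; p⊂q⇒∣p∣<∣q∣; x∈p∪q⁺; x∈p∪q⁻; x∈⁅x⁆; x∈⁅y⁆⇒x≡y)
import Data.Bool.Properties as Bool
open import Data.List using (List; length; lookup; cartesianProduct; allFin)
open import Data.List.Membership.Propositional.Properties
  using (∈-filter⁺; ∈-filter⁻; ∈-lookup; ∈-cartesianProduct⁺; ∈-allFin)
open import Data.List.Relation.Unary.All as All using ()
open import Data.List.Relation.Unary.AllPairs using (_∷_)
open import Data.List.Relation.Unary.Any using (index)
open import Data.List.Relation.Unary.Any.Properties using (lookup-index)
open import Data.List.Relation.Unary.Unique.Propositional using (Unique)
open import Data.List.Relation.Unary.Unique.Propositional.Properties
  using (filter⁺; cartesianProduct⁺; allFin⁺)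
open import Data.Nat using (ℕ; _<_)
open import Data.Nat.Properties using (<-asym)
open import Data.Product using (Σ; _×_; _,_; ∃; ∃₂; proj₁; proj₂)
open import Data.Product.Properties as Product using (,-injectiveˡ; ,-injectiveʳ)
open import Data.Sum using (_⊎_; inj₁; inj₂; [_,_]′)
open import Data.Vec.Properties using (lookup⇒[]=; []=⇒lookup; lookup∘tabulate)
import Data.Vec.Properties as Vec
open import Function using (_∘_)
open import Function.Bundles using (_⇔_; mk⇔)
open import Level using (0ℓ)
open import Relation.Binary.PropositionalEquality
  using (_≡_; _≢_; refl; sym; trans; cong; cong₂; subst)
open import Relation.Nullary using (¬_; does; yes; no; contradiction)
open import Relation.Nullary.Decidable
  using (_×-dec_; _⊎-dec_; _→-dec_; dec-true; decidable-stable)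
open import Relation.Unary using (Pred; Decidable)

-- Subsets cut out by decidable predicates, and lookup in lists.

module _ {n : ℕ} {P : Pred (Fin n) 0ℓ} (P? : Decidable P) where

  ∈⟦⟧⁺ : ∀ {x} → P x → x ∈ ⟦ P? ⟧
  ∈⟦⟧⁺ {x} px = lookup⇒[]= x _ (trans (lookup∘tabulate _ x) (dec-true (P? x) px))

  ∈⟦⟧⁻ : ∀ {x} → x ∈ ⟦ P? ⟧ → P x
  ∈⟦⟧⁻ {x} x∈ with P? x | trans (sym (lookup∘tabulate (λ y → does (P? y)) x)) ([]=⇒lookup x∈)
  ... | yes px | _ = px
  ... | no _   | ()

⊆∧⊄⇒≡ : ∀ {n} {p q : Subset n} → p ⊆ q → ¬ p ⊂ q → p ≡ q
⊆∧⊄⇒≡ {p = p} p⊆q p⊄q = ⊆-antisym p⊆q λ {x} x∈q →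
  decidable-stable (x ∈? p) λ x∉p → p⊄q (p⊆q , x , x∈q , x∉p)

lookup-injective : ∀ {A : Set} {xs : List A} → Unique xs →
                   ∀ i j → lookup xs i ≡ lookup xs j → i ≡ j
lookup-injective (_ ∷ _)    zero    zero    _  = refl
lookup-injective (x∉ ∷ _)   zero    (suc j) eq = contradiction eq (All.lookup x∉ (∈-lookup j))
lookup-injective (x∉ ∷ _)   (suc i) zero    eq = contradiction (sym eq) (All.lookup x∉ (∈-lookup i))
lookup-injective (_ ∷ uniq) (suc i) (suc j) eq = cong suc (lookup-injective uniq i j eq)

-- Bounds, neighborhoods and maximal dicliques of an arbitrary digraph.

module _ {n : ℕ} {G : Digraph n} {X : Subset n} where
  open Digraph G

  upperBound? : Decidable (λ u → ∀ x → x ∈ X → x ⟶ u)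
  upperBound? u = all? (λ x → (x ∈? X) →-dec (x ⟶? u))

  lowerBound? : Decidable (λ l → ∀ x → x ∈ X → l ⟶ x)
  lowerBound? l = all? (λ x → (x ∈? X) →-dec (l ⟶? x))

  ∈upperBounds⁺ : ∀ {u} → (∀ x → x ∈ X → x ⟶ u) → u ∈ upperBounds G X
  ∈upperBounds⁺ = ∈⟦⟧⁺ upperBound?

  ∈upperBounds⁻ : ∀ {u} → u ∈ upperBounds G X → ∀ x → x ∈ X → x ⟶ u
  ∈upperBounds⁻ = ∈⟦⟧⁻ upperBound?

  ∈lowerBounds⁺ : ∀ {l} → (∀ x → x ∈ X → l ⟶ x) → l ∈ lowerBounds G X
  ∈lowerBounds⁺ = ∈⟦⟧⁺ lowerBound?

  ∈lowerBounds⁻ : ∀ {l} → l ∈ lowerBounds G X → ∀ x → x ∈ X → l ⟶ x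
  ∈lowerBounds⁻ = ∈⟦⟧⁻ lowerBound?

module _ {n : ℕ} (G : Digraph n) where
  open Digraph G

  ∈N⁺⁺ : ∀ {v w} → v ⟶ w → w ∈ N⁺ G v
  ∈N⁺⁺ {v} = ∈⟦⟧⁺ (λ w → v ⟶? w)

  ∈N⁺⁻ : ∀ {v w} → w ∈ N⁺ G v → v ⟶ w
  ∈N⁺⁻ {v} = ∈⟦⟧⁻ (λ w → v ⟶? w)

  ∈N⁻⁺ : ∀ {v w} → v ⟶ w → v ∈ N⁻ G w
  ∈N⁻⁺ {w = w} = ∈⟦⟧⁺ (λ v → v ⟶? w)

  ∈N⁻⁻ : ∀ {v w} → v ∈ N⁻ G w → v ⟶ w
  ∈N⁻⁻ {w = w} = ∈⟦⟧⁻ (λ v → v ⟶? w)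

  ∈N⁺ : ∀ {v w} → v ⟶ w ⊎ w ⟶ v → w ∈ N G v
  ∈N⁺ = x∈p∪q⁺ ∘ [ inj₁ ∘ ∈N⁺⁺ , inj₂ ∘ ∈N⁻⁺ ]′

  ∈N⁻ : ∀ {v w} → w ∈ N G v → v ⟶ w ⊎ w ⟶ v
  ∈N⁻ {v} = [ inj₁ ∘ ∈N⁺⁻ , inj₂ ∘ ∈N⁻⁻ ]′ ∘ x∈p∪q⁻ (N⁺ G v) (N⁻ G v)

  ⊆-lowerBounds-upperBounds : ∀ {X} → X ⊆ lowerBounds G (upperBounds G X)
  ⊆-lowerBounds-upperBounds {_} {x} x∈X = ∈lowerBounds⁺ λ u u∈ → ∈upperBounds⁻ u∈ x x∈X

  disimplicial-⟶ : ∀ {v w x y} → Disimplicial G v w → x ⟶ w → v ⟶ y → x ⟶ y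
  disimplicial-⟶ (_ , d) x⟶w v⟶y = d _ _ (∈N⁻⁺ x⟶w) (∈N⁺⁺ v⟶y)

  -- A diclique `(V , W)` containing this pair has `X` inside `V`, which bounds `W` by
  -- `upperBounds G X`. It has `upperBounds G X` inside `W`, which bounds `V` in turn.
  closure-isMaximalDiclique : ∀ {X} → Nonempty X → Nonempty (upperBounds G X) →
    IsMaximalDiclique G (lowerBounds G (upperBounds G X) , upperBounds G X)
  closure-isMaximalDiclique {X} (x , x∈X) μX≢∅ =
    ((x , ⊆-lowerBounds-upperBounds x∈X) , μX≢∅ , λ v w v∈ w∈ → ∈lowerBounds⁻ v∈ w w∈) ,
    λ { (V , W) (_ , _ , V⟶W) (λμX⊆V , μX⊆W , ≢) →
        let W⊆μX : W ⊆ upperBounds G X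
            W⊆μX w∈W = ∈upperBounds⁺ λ x x∈X →
              V⟶W x _ (λμX⊆V (⊆-lowerBounds-upperBounds x∈X)) w∈W
            V⊆λμX : V ⊆ lowerBounds G (upperBounds G X)
            V⊆λμX v∈V = ∈lowerBounds⁺ λ u u∈ → V⟶W _ u v∈V (μX⊆W u∈)
        in ≢ (cong₂ _,_ (⊆-antisym λμX⊆V V⊆λμX) (⊆-antisym μX⊆W W⊆μX)) }

  maximalDiclique-≡ : ∀ {C D} → IsMaximalDiclique G C → IsDiclique G D →
                      proj₁ C ⊆ proj₁ D → proj₂ C ⊆ proj₂ D → C ≡ D
  maximalDiclique-≡ {C} {D} (_ , max) D-dic V⊆ W⊆ =
    decidable-stable (Product.≡-dec (Vec.≡-dec Bool._≟_) (Vec.≡-dec Bool._≟_) C D)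
      λ C≢D → max D D-dic (V⊆ , W⊆ , C≢D)

  -- `(V , upperBounds G V)` is again a diclique and contains `(V , W)`, so maximality makes the two
  -- equal.
  upperBounds⊆maximal : ∀ {V W} → IsMaximalDiclique G (V , W) → upperBounds G V ⊆ W
  upperBounds⊆maximal {V} {W} max@((V≢∅ , W≢∅ , V⟶W) , _) u∈ =
    subst (_ ∈_) (sym (,-injectiveʳ V,W≡V,μV)) u∈
    where
    W⊆μV : W ⊆ upperBounds G V
    W⊆μV w∈W = ∈upperBounds⁺ λ v v∈V → V⟶W v _ v∈V w∈W
    V,W≡V,μV : (V , W) ≡ (V , upperBounds G V)
    V,W≡V,μV = maximalDiclique-≡ max
      (V≢∅ , (_ , W⊆μV (proj₂ W≢∅)) , λ v w v∈V w∈ → ∈upperBounds⁻ w∈ v v∈V)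
      (λ v∈V → v∈V) W⊆μV

  lowerBounds⊆maximal : ∀ {V W} → IsMaximalDiclique G (V , W) → lowerBounds G W ⊆ V
  lowerBounds⊆maximal {V} {W} max@((V≢∅ , W≢∅ , V⟶W) , _) l∈ =
    subst (_ ∈_) (sym (,-injectiveˡ V,W≡λW,W)) l∈
    where
    V⊆λW : V ⊆ lowerBounds G W
    V⊆λW v∈V = ∈lowerBounds⁺ λ w w∈W → V⟶W _ w v∈V w∈W
    V,W≡λW,W : (V , W) ≡ (lowerBounds G W , W)
    V,W≡λW,W = maximalDiclique-≡ max
      ((_ , V⊆λW (proj₂ V≢∅)) , W≢∅ , λ v w v∈ w∈W → ∈lowerBounds⁻ v∈ w w∈W)
      V⊆λW (λ w∈W → w∈W)

  -- Thin neighbors and the vertices of `Join G`.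

  thinNeighbor-unique : ∀ {v x y} → _IsThinNeighborOf_ G x v → _IsThinNeighborOf_ G y v → x ≡ y
  thinNeighbor-unique {v} {x} {y} (x∈N , x-min) (y∈N , y-min) =
    decidable-stable (x ≟ y) λ x≢y →
      <-asym (x-min y y∈N (x≢y ∘ sym)) (y-min x x∈N x≢y)

  -- Unfolds to the same lookup as the local `pair` of `Join`, so an arc `i ⟶ j` of `Join G` is by
  -- definition `proj₁ (joinPair i) ⟶ proj₂ (joinPair j)`.
  joinPair : Fin (length (joinVertices G)) → Fin n × Fin n
  joinPair = lookup (joinVertices G)

  joinPair-JoinVertex : ∀ i → JoinVertex G (joinPair i)
  joinPair-JoinVertex i = proj₂ (∈-filter⁻ (joinVertex? G)
    {xs = cartesianProduct (allFin n) (allFin n)} (∈-lookup i))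

  joinIndex : ∀ {v w} → JoinVertex G (v , w) → ∃ λ i → (v , w) ≡ joinPair i
  joinIndex {v} {w} vw = index vw∈ , lookup-index vw∈
    where vw∈ = ∈-filter⁺ (joinVertex? G) (∈-cartesianProduct⁺ (∈-allFin v) (∈-allFin w)) vw

  joinPair-injective : ∀ i j → joinPair i ≡ joinPair j → i ≡ j
  joinPair-injective = lookup-injective
    (filter⁺ (joinVertex? G) (cartesianProduct⁺ (allFin⁺ n) (allFin⁺ n)))

  -- Disimplicial arcs in ST graphs without twins.

  module _ (isST : IsST G) (noTwins : ∀ v w → ¬ Twins G v w) (noIsolated : ∀ v → ¬ Isolated G v) where

    -- The middle vertex would be neither a source nor a sink. With all three vertices equal, this
    -- excludes loops.
    no-path : ∀ {u v w} → u ⟶ v → ¬ v ⟶ w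
    no-path {v = v} u⟶v v⟶w = [ (λ so → so (_ , ∈N⁻⁺ u⟶v)) , (λ si → si (_ , ∈N⁺⁺ v⟶w)) ]′ (isST v)

    ∈N-source : ∀ {v w z} → v ⟶ w → z ∈ N G v → v ⟶ z
    ∈N-source v⟶w z∈ = [ (λ v⟶z → v⟶z) , (λ z⟶v → contradiction v⟶w (no-path z⟶v)) ]′ (∈N⁻ z∈)

    ∈N-sink : ∀ {v w z} → v ⟶ w → z ∈ N G w → z ⟶ w
    ∈N-sink v⟶w z∈ = [ (λ w⟶z → contradiction w⟶z (no-path v⟶w)) , (λ z⟶w → z⟶w) ]′ (∈N⁻ z∈)

    noIsolated-arc : ∀ v → ∃ λ w → v ⟶ w ⊎ w ⟶ v
    noIsolated-arc v = decidable-stable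
      (any? (λ w → (v ⟶? w) ⊎-dec (w ⟶? v)))
      λ ∄ → noIsolated v λ { (w , w∈N) → ∄ (w , ∈N⁻ w∈N) }

    N-injective : ∀ {v w} → N G v ≡ N G w → v ≡ w
    N-injective {v} {w} eq = decidable-stable (v ≟ w) λ v≢w → noTwins v w (v≢w , eq)

    N-⊆⇒deg-< : ∀ {v w} → v ≢ w → N G v ⊆ N G w → deg G v < deg G w
    N-⊆⇒deg-< v≢w Nv⊆Nw = p⊂q⇒∣p∣<∣q∣ (decidable-stable (_ ⊂? _)
      λ Nv⊄Nw → v≢w (N-injective (⊆∧⊄⇒≡ Nv⊆Nw Nv⊄Nw)))

    N⁺-⊆⇒N-⊆ : ∀ {v v′ w} → v ⟶ w → (∀ {y} → v ⟶ y → v′ ⟶ y) → N G v ⊆ N G v′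
    N⁺-⊆⇒N-⊆ v⟶w f y∈ = ∈N⁺ (inj₁ (f (∈N-source v⟶w y∈)))

    N⁻-⊆⇒N-⊆ : ∀ {v w w′} → v ⟶ w → (∀ {x} → x ⟶ w → x ⟶ w′) → N G w ⊆ N G w′
    N⁻-⊆⇒N-⊆ v⟶w f x∈ = ∈N⁺ (inj₂ (f (∈N-sink v⟶w x∈)))

    disimplicial⇒thin : ∀ {v w} → Disimplicial G v w → Thin G v w
    disimplicial⇒thin d@(v⟶w , _) =
      v⟶w ,
      (∈N⁺ (inj₁ v⟶w) , λ z z∈ z≢w → N-⊆⇒deg-< (z≢w ∘ sym)
        (N⁻-⊆⇒N-⊆ v⟶w λ x⟶w → disimplicial-⟶ d x⟶w (∈N-source v⟶w z∈))) ,
      (∈N⁺ (inj₂ v⟶w) , λ z z∈ z≢v → N-⊆⇒deg-< (z≢v ∘ sym)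
        (N⁺-⊆⇒N-⊆ v⟶w λ v⟶y → disimplicial-⟶ d (∈N-sink v⟶w z∈) v⟶y))

    -- Supplies antisymmetry of `Join G`, where `v ⟶ y` and `x ⟶ w` are opposite arcs between
    -- `(v , w)` and `(x , y)`. Disimpliciality of the two arcs yields opposite inclusions of
    -- neighborhoods.
    disimplicial-cycle : ∀ {v w x y} → Disimplicial G v w → Disimplicial G x y →
                         v ⟶ y → x ⟶ w → v ≡ x × w ≡ y
    disimplicial-cycle dvw dxy v⟶y x⟶w =
      N-injective (⊆-antisym
        (N⁺-⊆⇒N-⊆ v⟶y (disimplicial-⟶ dvw x⟶w)) (N⁺-⊆⇒N-⊆ x⟶w (disimplicial-⟶ dxy v⟶y))) ,
      N-injective (⊆-antisym
        (N⁻-⊆⇒N-⊆ x⟶w λ u⟶w → disimplicial-⟶ dvw u⟶w v⟶y)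
        (N⁻-⊆⇒N-⊆ v⟶y λ u⟶y → disimplicial-⟶ dxy u⟶y x⟶w))

    -- From DI to dedekind.

    module DI⇒Dedekind (isDI : IsDI G) where

      closure-disimplicial : ∀ {X} → Nonempty X → Nonempty (upperBounds G X) →
        ∃₂ λ v w → v ∈ lowerBounds G (upperBounds G X) × w ∈ upperBounds G X × Disimplicial G v w
      closure-disimplicial X≢∅ μX≢∅ = proj₂ (isDI _ (closure-isMaximalDiclique X≢∅ μX≢∅))

      -- The maximal diclique generated by `v` contains a disimplicial arc `v′ ⟶ w′`. As `v′` is
      -- below every out-neighbor of `v`, `N G v ⊆ N G v′`; as `v ⟶ w′`, disimpliciality gives the
      -- reverse inclusion. Hence `v′` is `v`.
      source-disimplicial : ∀ {v w} → v ⟶ w → ∃ λ w′ → Disimplicial G v w′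
      source-disimplicial {v} v⟶w
        with v′ , w′ , v′∈ , w′∈ , d ← closure-disimplicial (v , x∈⁅x⁆ v)
               (_ , ∈upperBounds⁺ λ x x∈ → subst (_⟶ _) (sym (x∈⁅y⁆⇒x≡y v x∈)) v⟶w)
        = w′ , subst (λ u → Disimplicial G u w′) (sym v≡v′) d
        where
        v⟶w′ : v ⟶ w′
        v⟶w′ = ∈upperBounds⁻ w′∈ v (x∈⁅x⁆ v)
        v≡v′ : v ≡ v′
        v≡v′ = N-injective (⊆-antisym
          (N⁺-⊆⇒N-⊆ v⟶w λ v⟶y → ∈lowerBounds⁻ v′∈ _ (∈upperBounds⁺ λ x x∈ →
            subst (_⟶ _) (sym (x∈⁅y⁆⇒x≡y v x∈)) v⟶y))
          (N⁺-⊆⇒N-⊆ (proj₁ d) (disimplicial-⟶ d v⟶w′)))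

      -- The generating set is not `⁅ w ⁆`, which has no upper bound since `w` is a sink, but the
      -- set of in-neighbors of `w`, which has `w` as an upper bound.
      sink-disimplicial : ∀ {v w} → v ⟶ w → ∃ λ v′ → Disimplicial G v′ w
      sink-disimplicial {v} {w} v⟶w
        with v′ , w′ , v′∈ , w′∈ , d ← closure-disimplicial {lowerBounds G ⁅ w ⁆}
               (v , ∈lowerBounds⁺ λ x x∈ → subst (_ ⟶_) (sym (x∈⁅y⁆⇒x≡y w x∈)) v⟶w)
               (w , ∈upperBounds⁺ λ x x∈ → ∈lowerBounds⁻ x∈ w (x∈⁅x⁆ w))
        = v′ , subst (Disimplicial G v′) (sym w≡w′) d
        where
        v′⟶w : v′ ⟶ w
        v′⟶w = ∈lowerBounds⁻ v′∈ w (∈upperBounds⁺ λ x x∈ → ∈lowerBounds⁻ x∈ w (x∈⁅x⁆ w))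
        w≡w′ : w ≡ w′
        w≡w′ = N-injective (⊆-antisym
          (N⁻-⊆⇒N-⊆ v⟶w λ x⟶w → ∈upperBounds⁻ w′∈ _ (∈lowerBounds⁺ λ y y∈ →
            subst (_ ⟶_) (sym (x∈⁅y⁆⇒x≡y w y∈)) x⟶w))
          (N⁻-⊆⇒N-⊆ (proj₁ d) λ x⟶w′ → disimplicial-⟶ d x⟶w′ v′⟶w))

      -- The disimplicial arc out of `v` is itself thin, and the thin neighbor of `v` is unique.
      thin⇒disimplicial : ∀ {v w} → Thin G v w → Disimplicial G v w
      thin⇒disimplicial {v} (v⟶w , θv , _) with w′ , d ← source-disimplicial v⟶w =
        subst (Disimplicial G v)
          (thinNeighbor-unique (proj₁ (proj₂ (disimplicial⇒thin d))) θv) d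

      allMatched : ∀ v → Matched G v
      allMatched v with noIsolated-arc v
      ... | _ , inj₁ v⟶w = let w , d = source-disimplicial v⟶w in w , inj₁ (disimplicial⇒thin d)
      ... | _ , inj₂ w⟶v = let w , d = sink-disimplicial w⟶v in w , inj₂ (disimplicial⇒thin d)

      joinPair-disimplicial : ∀ i → Disimplicial G (proj₁ (joinPair i)) (proj₂ (joinPair i))
      joinPair-disimplicial i with joinPair-JoinVertex i
      ... | inj₁ (_ , unmatched) = contradiction (allMatched _) unmatched
      ... | inj₂ thin            = thin⇒disimplicial thin

      join-isOrderGraph : IsOrderGraph (Join G)
      join-isOrderGraph =
        (λ {i} → proj₁ (joinPair-disimplicial i)) ,
        -- An arc `i ⟶ j` enters the sink of the pair at `j`, and `j ⟶ k` leaves its source: the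
        -- configuration of disimpliciality.
        (λ {_} {j} i⟶j j⟶k → disimplicial-⟶ (joinPair-disimplicial j) i⟶j j⟶k) ,
        λ {i} {j} i⟶j j⟶i →
          let v≡x , w≡y = disimplicial-cycle (joinPair-disimplicial i) (joinPair-disimplicial j) i⟶j j⟶i
          in joinPair-injective i j (cong₂ _,_ v≡x w≡y)

      module _ (X : Subset (length (joinVertices G))) where

        source? : Decidable (λ v → ∃ λ j → j ∈ X × v ≡ proj₁ (joinPair j))
        source? v = any? λ j → (j ∈? X) ×-dec (v ≟ proj₁ (joinPair j))

        sources : Subset n
        sources = ⟦ source? ⟧

        ∈sources⁺ : ∀ {j} → j ∈ X → proj₁ (joinPair j) ∈ sources
        ∈sources⁺ {j} j∈X = ∈⟦⟧⁺ source? (j , j∈X , refl)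

        upperBounds-sources : ∀ {u} → u ∈ upperBounds (Join G) X →
                              proj₂ (joinPair u) ∈ upperBounds G sources
        upperBounds-sources {u} u∈ = ∈upperBounds⁺ λ v v∈ →
          let j , j∈X , v≡ = ∈⟦⟧⁻ source? v∈
          in subst (_⟶ proj₂ (joinPair u)) (sym v≡) (∈upperBounds⁻ u∈ j j∈X)

        supremum : Nonempty X → Nonempty (upperBounds (Join G) X) → ∃ λ s → IsSupremum (Join G) s X
        supremum (i , i∈X) (u , u∈)
          with v , w , v∈ , w∈ , d ← closure-disimplicial
                 (_ , ∈sources⁺ i∈X) (_ , upperBounds-sources u∈)
          -- The arc `v ⟶ w` is thin, hence a vertex of `Join G`. Its sink is above all sources of
          -- `X`; its source is below the sinks of all upper bounds of `X`.
          with k , refl ← joinIndex (inj₂ (disimplicial⇒thin d))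
          = k ,
            ∈upperBounds⁺ (λ j j∈X → ∈upperBounds⁻ w∈ _ (∈sources⁺ j∈X)) ,
            ∈lowerBounds⁺ (λ j j∈ → ∈lowerBounds⁻ v∈ _ (upperBounds-sources j∈))

      join-isDedekind : IsDedekind (Join G)
      join-isDedekind = join-isOrderGraph , supremum

    -- From dedekind to DI.

    module Dedekind⇒DI (isDedekind : IsDedekind (Join G)) where

      joinPair-⟶ : ∀ i → proj₁ (joinPair i) ⟶ proj₂ (joinPair i)
      joinPair-⟶ i = proj₁ (proj₁ isDedekind) {i}

      -- An unmatched `v` would give `Join G` the vertex `(v , v)`, whose reflexivity is a loop at
      -- `v` in `G`.
      allMatched : ∀ v → Matched G v
      allMatched v = decidable-stable (matched? G v) λ unmatched →
        let i , eq = joinIndex (inj₁ (refl , unmatched))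
            v⟶v = subst (λ (x , y) → x ⟶ y) (sym eq) (joinPair-⟶ i)
        in no-path v⟶v v⟶v

      source-thin : ∀ {v w} → v ⟶ w → ∃ λ w′ → Thin G v w′
      source-thin {v} v⟶w with allMatched v
      ... | w′ , inj₁ thin       = w′ , thin
      ... | w′ , inj₂ (w′⟶v , _) = contradiction v⟶w (no-path w′⟶v)

      sink-thin : ∀ {v w} → v ⟶ w → ∃ λ v′ → Thin G v′ w
      sink-thin {_} {w} v⟶w with allMatched w
      ... | v′ , inj₁ (w⟶v′ , _) = contradiction w⟶v′ (no-path v⟶w)
      ... | v′ , inj₂ thin       = v′ , thin

      joinPair-disimplicial : ∀ i → Disimplicial G (proj₁ (joinPair i)) (proj₂ (joinPair i))
      joinPair-disimplicial i = joinPair-⟶ i , λ x y x∈ y∈ → composite (∈N⁻⁻ x∈) (∈N⁺⁻ y∈)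
        where
        composite : ∀ {x y} → x ⟶ proj₂ (joinPair i) → proj₁ (joinPair i) ⟶ y → x ⟶ y
        composite x⟶w v⟶y
          -- Completing `x` and `y` to thin arcs gives vertices `j` and `k` of `Join G` with `j ⟶ i`
          -- and `i ⟶ k`; the arc `j ⟶ k` is then `x ⟶ y`.
          with _ , thin-x ← source-thin x⟶w
             | _ , thin-y ← sink-thin v⟶y
          with j , refl ← joinIndex (inj₂ thin-x)
             | k , refl ← joinIndex (inj₂ thin-y)
          = proj₁ (proj₂ (proj₁ isDedekind)) {j} {i} {k} x⟶w v⟶y

      module _ {V W : Subset n} (max : IsMaximalDiclique G (V , W)) where
        -- Fixing `v` and `w` gives every vertex of `V` an outgoing arc and every vertex of `W` an
        -- incoming one, as `source-thin` and `sink-thin` require.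
        open Σ (proj₁ (proj₁ max)) renaming (proj₁ to v; proj₂ to v∈V)
        open Σ (proj₁ (proj₂ (proj₁ max))) renaming (proj₁ to w; proj₂ to w∈W)
        V⟶W = proj₂ (proj₂ (proj₁ max))

        source∈V? : Decidable (λ i → proj₁ (joinPair i) ∈ V)
        source∈V? i = proj₁ (joinPair i) ∈? V

        X : Subset (length (joinVertices G))
        X = ⟦ source∈V? ⟧

        lift-source : ∀ {x} → x ∈ V → ∃ λ i → i ∈ X × proj₁ (joinPair i) ≡ x
        lift-source x∈V
          with i , eq ← joinIndex (inj₂ (proj₂ (source-thin (V⟶W _ w x∈V w∈W))))
          = i , ∈⟦⟧⁺ source∈V? (subst (_∈ V) (,-injectiveˡ eq) x∈V) , sym (,-injectiveˡ eq)

        lift-sink : ∀ {y} → y ∈ W → ∃ λ i → i ∈ upperBounds (Join G) X × proj₂ (joinPair i) ≡ y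
        lift-sink y∈W
          with i , eq ← joinIndex (inj₂ (proj₂ (sink-thin (V⟶W v _ v∈V y∈W))))
          = i ,
            ∈upperBounds⁺ (λ j j∈X → V⟶W _ _ (∈⟦⟧⁻ source∈V? j∈X) (subst (_∈ W) (,-injectiveʳ eq) y∈W)) ,
            sym (,-injectiveʳ eq)

        -- Every vertex of `W` is the sink of some upper bound of `X`, so the source of `s` has arcs
        -- to all of `W`, and maximality puts it in `V`.
        supremum-source : ∀ {s} → IsSupremum (Join G) s X → proj₁ (joinPair s) ∈ V
        supremum-source {s} (_ , s∈λμX) = lowerBounds⊆maximal max (∈lowerBounds⁺ λ y y∈W →
          let i , i∈ , ≡y = lift-sink y∈W
          in subst (proj₁ (joinPair s) ⟶_) ≡y (∈lowerBounds⁻ s∈λμX i i∈))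

        supremum-sink : ∀ {s} → IsSupremum (Join G) s X → proj₂ (joinPair s) ∈ W
        supremum-sink {s} (s∈μX , _) = upperBounds⊆maximal max (∈upperBounds⁺ λ x x∈V →
          let i , i∈ , ≡x = lift-source x∈V
          in subst (_⟶ proj₂ (joinPair s)) ≡x (∈upperBounds⁻ s∈μX i i∈))

        isReduced : IsReducedDiclique G (V , W)
        isReduced =
          let i , i∈X , _ = lift-source v∈V
              j , j∈μX , _ = lift-sink w∈W
              s , sup = proj₂ isDedekind X (i , i∈X) (j , j∈μX)
          in max , proj₁ (joinPair s) , proj₂ (joinPair s) ,
             supremum-source sup , supremum-sink sup , joinPair-disimplicial s

      isDI : IsDI G
      isDI _ = isReduced

    DI⇔joinDedekind : IsDI G ⇔ IsDedekind (Join G)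
    DI⇔joinDedekind = mk⇔ DI⇒Dedekind.join-isDedekind Dedekind⇒DI.isDI

theorem18 : ∀ (n : ℕ) (G : Digraph n) → IsST G → (∀ v w → ¬ Twins G v w) → (∀ v → ¬ Isolated G v) → IsDI G ⇔ IsDedekind (Join G)
theorem18 n G = DI⇔joinDedekind G
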